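{- Let $r > 1$ and $k > 1$ be integers with $W(r,k) > \max(\{r,k\})$, let $n \geq 1$ be the exponent of the leading power of $r$ in the base-$r$ expansion of $W(r,k)$, and suppose that $W(r,k) < r^{n+1} \leq r^{k^{2}}$ (the second inequality being the condition $k \geq \sqrt{n+1}$). Then the following five conditions also hold: 1. $n > \dfrac{\log k}{\log r} - 1$. 2. $\sqrt[n+1]{k} = O(r)$. 3. For each triplet $n, r, k$ there exists $a(r,k) \in \mathbb{R}$ such that $n = a(r,k)\dfrac{\log k}{\log r} - 1$ if and only if $a(r,k) = (n+1)\dfrac{\log r}{\log k}$, where, if $r<k$ then $a(r,k) < n+1$, if $r = k$ then $a(r,k) = n+1$, and if $r > k$ then $a(r,k) > n+1$. 4. For each triplet $n, r, k$ there exists $a(r,k) \in \mathbb{R}$ such that $k = r^{\frac{n+1}{a(r,k)}}$ if and only if $a(r,k) = (n+1)\dfrac{\log r}{\log k}$, where, if $r<k$ then $a(r,k) < n+1$, if $r = k$ then $a(r,k) = n+1$, and if $r > k$ then $a(r,k) > n+1$. 5. For large $n$, $\dfrac{W(r,k)}{r^{n}} = O(r)$.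
   Context: For positive integers $r, k$, the van der Waerden number $W(r,k)$ is the least positive integer $N$ such that every coloring of the integer interval $[1,N]=\{1,\dots,N\}$ with $r$ colors contains a monochromatic arithmetic progression of $k$ terms. For $W(r,k) > r > 1$, write the base-$r$ expansion $W(r,k) = b_{n}r^{n} + b_{n-1}r^{n-1} + \cdots + b_{0}$ with integers $1 \leq b_n \leq r-1$ and $0 \leq b_i \leq r-1$ for $i<n$; the exponent $n$ of the leading power is the unique integer with $r^{n} \leq W(r,k) < r^{n+1}$. $O(\cdot)$ is the usual big-O notation. -}

module Defs where

open import Algebra.Apartness.Bundles using (HeytingCommutativeRing; HeytingField)
import Algebra.Apartness.Properties.HeytingCommutativeRing as HCRProperties
import Algebra.Definitions.RawMonoid as RawMonoidDefs
open import Algebra.Bundles using (CommutativeRing)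
open import Algebra.Morphism.Structures using (IsMonoidHomomorphism; module IsMonoidHomomorphism)
import Algebra.Properties.Ring as RingProperties
open import Data.Digit using (Digit; fromDigits)
open import Data.Fin.Base using (Fin; toℕ)
open import Data.List.Base using (_∷ʳ_)
open import Data.Nat.Base as ℕ using (ℕ; zero; suc)
import Data.Nat.Properties as ℕ
open import Data.Product.Base using (∃-syntax; _×_; _,_; proj₁)
open import Data.Sum.Base using (_⊎_; inj₁; inj₂)
open import Data.Vec.Base using (Vec; toList)
open import Function.Bundles using (_⇔_)
open import Level using (_⊔_) renaming (suc to lsuc)
open import Relation.Binary.Core using (Rel)
open import Relation.Binary.PropositionalEquality.Core using (_≡_)
open import Relation.Binary.Structures using (IsStrictPartialOrder)
open import Relation.Nullary.Negation using (¬_; contradiction)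

-- The element i : Fin N stands for the integer suc (toℕ i) of [1, N].
Coloring : ℕ → ℕ → Set
Coloring r N = Fin N → Fin r

HasMonochromaticAP : ∀ {r N} → ℕ → Coloring r N → Set
HasMonochromaticAP {r} {N} k colour =
  ∃[ a ] ∃[ d ] 1 ℕ.≤ d × ∃[ c ]
    ((j : Fin k) → ∃[ i ] suc (toℕ i) ≡ a ℕ.+ toℕ j ℕ.* d × colour i ≡ c)

EveryColoringHasAP : ℕ → ℕ → ℕ → Set
EveryColoringHasAP r k N = (colour : Coloring r N) → HasMonochromaticAP k colour

-- IsVanDerWaerden r k W says W = W(r,k).  It is a relation because producing
-- W(r,k) as a value amounts to van der Waerden's theorem.
record IsVanDerWaerden (r k W : ℕ) : Set where
  field
    positive : 1 ℕ.≤ W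
    property : EveryColoringHasAP r k W
    least    : ∀ N → 1 ℕ.≤ N → EveryColoringHasAP r k N → W ℕ.≤ N

-- Digits run from b₀ to bₙ, the order expected by fromDigits.
record HasLeadingExponent (r n W : ℕ) : Set where
  field
    lowerDigits   : Vec (Digit r) n
    leadingDigit  : Digit r
    leadingDigit≥1 : 1 ℕ.≤ toℕ leadingDigit
    expansion     : fromDigits (toList lowerDigits ∷ʳ leadingDigit) ≡ W

record Parameters : Set where
  field
    r k W n         : ℕ
    r>1             : r ℕ.> 1
    k>1             : k ℕ.> 1
    isVanDerWaerden : IsVanDerWaerden r k W
    W>max           : W ℕ.> r ℕ.⊔ k
    n≥1             : n ℕ.≥ 1
    leadingExponent : HasLeadingExponent r n W
    W<rⁿ⁺¹          : W ℕ.< r ℕ.^ suc n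
    rⁿ⁺¹≤rᵏ²        : r ℕ.^ suc n ℕ.≤ r ℕ.^ (k ℕ.^ 2)

  instance
    r-nonTrivial : ℕ.NonTrivial r
    r-nonTrivial = ℕ.n>1⇒nonTrivial r>1

    k-nonTrivial : ℕ.NonTrivial k
    k-nonTrivial = ℕ.n>1⇒nonTrivial k>1

    r-nonZero : ℕ.NonZero r
    r-nonZero = ℕ.nonTrivial⇒nonZero r

    k-nonZero : ℕ.NonZero k
    k-nonZero = ℕ.nonTrivial⇒nonZero k

    rⁿ-nonZero : ℕ.NonZero (r ℕ.^ n)
    rⁿ-nonZero = ℕ.m^n≢0 r n

-- A Cauchy complete Archimedean ordered field: classically these axioms
-- determine the reals up to isomorphism, and constructively they hold of the
-- Cauchy reals.
record RealNumbers c ℓ₁ ℓ₂ : Set (lsuc (c ⊔ ℓ₁ ⊔ ℓ₂)) where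
  field
    heytingField : HeytingField c ℓ₁ ℓ₂

  open HeytingField heytingField public renaming (Carrier to ℝ)

  commutativeRing : CommutativeRing c ℓ₁
  commutativeRing = HeytingCommutativeRing.commutativeRing heytingCommutativeRing

  open CommutativeRing commutativeRing public
    using (ring; +-rawMonoid; *-rawMonoid)

  open RawMonoidDefs +-rawMonoid using () renaming (_×_ to _·_)

  fromℕ : ℕ → ℝ
  fromℕ m = m · 1#

  infix 4 _<_

  field
    _<_                  : Rel ℝ ℓ₂
    <-isStrictPartialOrder : IsStrictPartialOrder _≈_ _<_
    <⇒#                  : ∀ {x y} → x < y → x # y
    #⇒<⊎>                : ∀ {x y} → x # y → x < y ⊎ y < x
    0<1                  : 0# < 1#
    +-monoʳ-<            : ∀ x {y z} → y < z → x + y < x + z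
    *-pos                : ∀ {x y} → 0# < x → 0# < y → 0# < x * y
    archimedean          : ∀ x → ∃[ m ] x < fromℕ m

  -- The roles of m and m′ may be exchanged, so this bounds ∣ f m - f m′ ∣ by
  -- 1 / (j + 1).
  IsCauchy : (ℕ → ℝ) → Set ℓ₂
  IsCauchy f = ∀ j → ∃[ N ] ∀ m m′ → N ℕ.≤ m → N ℕ.≤ m′ →
    fromℕ (suc j) * (f m - f m′) < 1#

  _ConvergesTo_ : (ℕ → ℝ) → ℝ → Set ℓ₂
  f ConvergesTo x = ∀ j → ∃[ N ] ∀ m → N ℕ.≤ m →
    fromℕ (suc j) * (f m - x) < 1# × fromℕ (suc j) * (x - f m) < 1#

  field
    complete : ∀ f → IsCauchy f → ∃[ x ] f ConvergesTo x

  infix 4 _≤_ _>_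

  _≤_ : Rel ℝ ℓ₂
  x ≤ y = ¬ (y < x)

  _>_ : Rel ℝ ℓ₂
  x > y = y < x

-- The natural exponential is the only homomorphism from (ℝ , +) to (ℝ , *)
-- with 1 + x ≤ exp x; the natural logarithm is its inverse on the positive
-- reals.
record ExpLog {c ℓ₁ ℓ₂} (R : RealNumbers c ℓ₁ ℓ₂) : Set (c ⊔ ℓ₁ ⊔ ℓ₂) where
  open RealNumbers R
  field
    exp               : ℝ → ℝ
    exp-homomorphism  : IsMonoidHomomorphism +-rawMonoid *-rawMonoid exp
    1+x≤exp           : ∀ x → 1# + x ≤ exp x
    log              : ∀ x → 0# < x → ℝ
    exp-log           : ∀ x (x>0 : 0# < x) → exp (log x x>0) ≈ x

module Analysis {c ℓ₁ ℓ₂} (R : RealNumbers c ℓ₁ ℓ₂) (E : ExpLog R) where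

  open RealNumbers R public
  open ExpLog E public
  private
    module HCR = HCRProperties heytingCommutativeRing
    module < = IsStrictPartialOrder <-isStrictPartialOrder
    module exp = IsMonoidHomomorphism exp-homomorphism
  open RingProperties ring using (-‿distribʳ-*; -‿distribˡ-*)

  infix 7 _÷_⟨_⟩

  -- #⇒invertible inverts y - 0#.
  _÷_⟨_⟩ : ∀ x y → y # 0# → ℝ
  x ÷ y ⟨ y#0 ⟩ = x * proj₁ (#⇒invertible y#0)

  power : ∀ x → 0# < x → ℝ → ℝ
  power x x>0 y = exp (y * log x x>0)

  private
    +-mono-0< : ∀ {x y} → 0# < x → 0# < y → x < x + y
    +-mono-0< {x} {y} _ y>0 = <.<-respˡ-≈ (+-identityʳ x) (+-monoʳ-< x y>0)

    fromℕ>0 : ∀ m → 0# < fromℕ (suc m)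
    fromℕ>0 zero    = <.<-respʳ-≈ (sym (+-identityʳ 1#)) 0<1
    fromℕ>0 (suc m) = <.trans 0<1 (+-mono-0< 0<1 (fromℕ>0 m))

    1<fromℕ : ∀ m → 1# < fromℕ (suc (suc m))
    1<fromℕ m = +-mono-0< 0<1 (fromℕ>0 m)

    x<y⇒0<y-x : ∀ {x y} → x < y → 0# < y - x
    x<y⇒0<y-x {x} {y} x<y =
      <.<-respˡ-≈ (-‿inverseˡ x) (<.<-respʳ-≈ (+-comm (- x) y) (+-monoʳ-< (- x) x<y))

    0<y-x⇒x<y : ∀ {x y} → 0# < y - x → x < y
    0<y-x⇒x<y {x} {y} p =
      <.<-respˡ-≈ (+-identityʳ x) (<.<-respʳ-≈ eq (+-monoʳ-< x p))
      where
      eq : x + (y - x) ≈ y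
      eq = trans (+-congˡ (+-comm y (- x)))
             (trans (sym (+-assoc x (- x) y))
               (trans (+-congʳ (-‿inverseʳ x)) (+-identityˡ y)))

    <-cotrans : ∀ {x y} → x < y → ∀ z → x < z ⊎ z < y
    <-cotrans x<y z with #-cotrans (<⇒# x<y) z
    ... | inj₁ x#z with #⇒<⊎> x#z
    ...   | inj₁ x<z = inj₁ x<z
    ...   | inj₂ z<x = inj₂ (<.trans z<x x<y)
    <-cotrans x<y z | inj₂ z#y with #⇒<⊎> z#y
    ...   | inj₁ z<y = inj₂ z<y
    ...   | inj₂ y<z = inj₁ (<.trans x<y y<z)

    *-pos-cancel : ∀ {x y} → 0# < y → x * y ≈ 1# → 0# < x
    *-pos-cancel {x} {y} y>0 xy≈1 with #⇒<⊎> x#0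
      where
      x#0 : x # 0#
      x#0 = HCR.invertibleʳ⇒# (y , trans (*-congʳ (HCR.x-0≈x x)) xy≈1)
    ... | inj₂ x>0 = x>0
    ... | inj₁ x<0 = contradiction (<.trans 0<1 (0<y-x⇒x<y (<.<-respʳ-≈ eq -xy>0)))
                       (<.irrefl refl)
      where
      -xy>0 : 0# < (0# - x) * y
      -xy>0 = *-pos (x<y⇒0<y-x x<0) y>0
      eq : (0# - x) * y ≈ 0# - 1#
      eq = trans (*-congʳ (+-identityˡ (- x)))
             (trans (sym (-‿distribˡ-* x y))
               (trans (-‿cong xy≈1) (sym (+-identityˡ (- 1#)))))

    log>0 : ∀ {x} (x>0 : 0# < x) → 1# < x → 0# < log x x>0
    log>0 {x} x>0 x>1 with <-cotrans e<1 (1# + (- l))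
      where
      l = log x x>0
      e = exp (- l)
      ex≈1 : e * x ≈ 1#
      ex≈1 = trans (*-congˡ (sym (exp-log x x>0)))
               (trans (sym (exp.homo (- l) l))
                 (trans (exp.⟦⟧-cong (-‿inverseˡ l)) exp.ε-homo))
      e<1 : e < 1#
      e<1 = 0<y-x⇒x<y (<.<-respʳ-≈ eq (*-pos (*-pos-cancel x>0 ex≈1) (x<y⇒0<y-x x>1)))
        where
        eq : e * (x - 1#) ≈ 1# - e
        eq = trans (distribˡ e x (- 1#))
               (+-cong ex≈1 (trans (sym (-‿distribʳ-* e 1#)) (-‿cong (*-identityʳ e))))
    ... | inj₁ p = contradiction p (1+x≤exp (- log x x>0))
    ... | inj₂ p = 0<y-x⇒x<y (<.<-respʳ-≈ eq (x<y⇒0<y-x p))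
      where
      l = log x x>0
      eq : 1# - (1# + (- l)) ≈ l - 0#
      eq = trans (+-congˡ (trans (-‿+-comm⁻ 1# (- l)) (+-congˡ (-‿involutive l))))
             (trans (sym (+-assoc 1# (- 1#) l))
               (trans (+-congʳ (-‿inverseʳ 1#)) (trans (+-identityˡ l) (sym (HCR.x-0≈x l)))))
        where
        open RingProperties ring using (-‿involutive; -‿+-comm)
        -‿+-comm⁻ : ∀ x y → - (x + y) ≈ - x + - y
        -‿+-comm⁻ x y = sym (-‿+-comm x y)

  fromℕ-positive : ∀ m → {{ℕ.NonZero m}} → 0# < fromℕ m
  fromℕ-positive (suc m) = fromℕ>0 m

  fromℕ#0 : ∀ m → {{ℕ.NonZero m}} → fromℕ m # 0#
  fromℕ#0 m = #-sym (<⇒# (fromℕ-positive m))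

  logℕ : ∀ m → {{ℕ.NonZero m}} → ℝ
  logℕ m = log (fromℕ m) (fromℕ-positive m)

  logℕ#0 : ∀ m → {{_ : ℕ.NonZero m}} {{_ : ℕ.NonTrivial m}} → logℕ m # 0#
  logℕ#0 (suc (suc m)) = #-sym (<⇒# (log>0 (fromℕ-positive (suc (suc m))) (1<fromℕ m)))

  -- f = O(g), with an absolute constant over the whole family of admissible
  -- parameters.  The two bounds say ∣ f ∣ ≤ C g, the comparison function g
  -- being nonnegative.
  _=O_ : (f g : Parameters → ℝ) → Set (c ⊔ ℓ₂)
  f =O g = ∃[ C ] ∀ p → f p ≤ C * g p × - f p ≤ C * g p

  _=O_forLarge_ : (f g : Parameters → ℝ) → (Parameters → ℕ) → Set (c ⊔ ℓ₂)
  f =O g forLarge size =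
    ∃[ N ] ∃[ C ] ∀ p → size p ℕ.≥ N → f p ≤ C * g p × - f p ≤ C * g p

  module Conditions (p : Parameters) where
    open Parameters p

    log-k/log-r : ℝ
    log-k/log-r = logℕ k ÷ logℕ r ⟨ logℕ#0 r ⟩

    log-r/log-k : ℝ
    log-r/log-k = logℕ r ÷ logℕ k ⟨ logℕ#0 k ⟩

    ExponentLowerBound : Set ℓ₂
    ExponentLowerBound = fromℕ n > log-k/log-r - 1#

    [n+1]th-root-of-k : ℝ
    [n+1]th-root-of-k =
      power (fromℕ k) (fromℕ-positive k) (1# ÷ fromℕ (suc n) ⟨ fromℕ#0 (suc n) ⟩)

    W/rⁿ : ℝ
    W/rⁿ = fromℕ W ÷ fromℕ (r ℕ.^ n) ⟨ fromℕ#0 (r ℕ.^ n) ⟩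

    r-as-real : ℝ
    r-as-real = fromℕ r

    Comparison : ℝ → Set (ℓ₁ ⊔ ℓ₂)
    Comparison a =
      (r ℕ.< k → a < fromℕ (suc n)) ×
      (r ≡ k → a ≈ fromℕ (suc n)) ×
      (r ℕ.> k → a > fromℕ (suc n))

    SatisfiesExponentEquation : ℝ → Set ℓ₁
    SatisfiesExponentEquation a = fromℕ n ≈ a * log-k/log-r - 1#

    ExponentFormula : Set (c ⊔ ℓ₁ ⊔ ℓ₂)
    ExponentFormula = ∃[ a ]
      SatisfiesExponentEquation a ×
      (∀ b → SatisfiesExponentEquation b ⇔ b ≈ fromℕ (suc n) * log-r/log-k) ×
      Comparison a

    -- The exponent (n + 1) / a only makes sense for a apart from 0.
    SatisfiesPowerEquation : ∀ a → a # 0# → Set ℓ₁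
    SatisfiesPowerEquation a a#0 =
      fromℕ k ≈ power (fromℕ r) (fromℕ-positive r) (fromℕ (suc n) ÷ a ⟨ a#0 ⟩)

    PowerFormula : Set (c ⊔ ℓ₁ ⊔ ℓ₂)
    PowerFormula = ∃[ a ] ∃[ a#0 ]
      SatisfiesPowerEquation a a#0 ×
      (∀ b b#0 → SatisfiesPowerEquation b b#0 ⇔ b ≈ fromℕ (suc n) * log-r/log-k) ×
      Comparison a

{-# OPTIONS --safe #-}
module Submission where

-- Everything follows from k < W < rⁿ⁺¹.  The logarithm is strictly increasing,
-- so log k < (n + 1) log r, which gives 1 and 2; dividing W < rⁿ⁺¹ by rⁿ gives
-- 5, and in both estimates the constant is 1.  In 3 and 4 either equation for a
-- amounts to a log k = (n + 1) log r.

open import Algebra.Bundles using (CommutativeRing)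
import Algebra.Apartness.Properties.HeytingCommutativeRing as HeytingCommutativeRingProperties
open import Algebra.Morphism.Structures using (module IsMonoidHomomorphism)
import Algebra.Properties.Ring as RingProperties
import Algebra.Properties.Semiring.Mult as SemiringMult
open import Data.Nat.Base as ℕ using (ℕ; zero; suc)
import Data.Nat.Properties as ℕ
open import Data.Product.Base using (_×_; _,_; proj₁; proj₂)
open import Data.Sum.Base using (_⊎_; inj₁; inj₂; [_,_])
open import Defs
open import Function.Base using (_∘_)
open import Function.Bundles using (_⇔_; mk⇔; module Equivalence)
open import Function.Properties.Equivalence using (⇔-setoid)
open import Relation.Binary.Bundles using (StrictPartialOrder)
import Relation.Binary.PropositionalEquality.Core as ≡
import Relation.Binary.Reasoning.Setoid as SetoidReasoning
import Relation.Binary.Reasoning.StrictPartialOrder as StrictPartialOrderReasoning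
open import Relation.Nullary.Negation using (¬_; contradiction)

module _ {c ℓ₁ ℓ₂} (R : RealNumbers c ℓ₁ ℓ₂) (E : ExpLog R) where

  open Analysis R E
  open CommutativeRing commutativeRing using (semiring)
  open RingProperties ring using ([y-z]x≈yx-zx)
  open HeytingCommutativeRingProperties heytingCommutativeRing using (x-0≈x; invertibleʳ⇒#)
  open SemiringMult semiring using (×1-homo-*)

  private
    <-strictPartialOrder : StrictPartialOrder c ℓ₁ ℓ₂
    <-strictPartialOrder = record { isStrictPartialOrder = <-isStrictPartialOrder }

    module < = StrictPartialOrder <-strictPartialOrder
    module exp = IsMonoidHomomorphism exp-homomorphism
    module ≈-Reasoning = SetoidReasoning setoid
    module <-Reasoning = StrictPartialOrderReasoning <-strictPartialOrder
    module ⇔-Reasoning = SetoidReasoning (⇔-setoid ℓ₁)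

    variable
      x y z : ℝ

  -- Order

  <⇒≤ : x < y → x ≤ y
  <⇒≤ = <.asym

  -- Constructive stand-in for trichotomy, inherited from cotransitivity of apartness. As `≤` is
  -- only the negation of the reversed `<`, the mixed transitivity laws below rest on it.
  <-cotrans : x < y → ∀ z → x < z ⊎ z < y
  <-cotrans x<y z with #-cotrans (<⇒# x<y) z
  ... | inj₁ x#z = [ inj₁ , (λ z<x → inj₂ (<.trans z<x x<y)) ] (#⇒<⊎> x#z)
  ... | inj₂ z#y = [ inj₂ , (λ y<z → inj₁ (<.trans x<y y<z)) ] (#⇒<⊎> z#y)

  <-≤-trans : x < y → y ≤ z → x < z
  <-≤-trans {z = z} x<y y≤z with <-cotrans x<y z
  ... | inj₁ x<z = x<z
  ... | inj₂ z<y = contradiction z<y y≤z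

  ≤-<-trans : x ≤ y → y < z → x < z
  ≤-<-trans {x = x} x≤y y<z with <-cotrans y<z x
  ... | inj₁ y<x = contradiction y<x x≤y
  ... | inj₂ x<z = x<z

  -- Tightness of apartness: an equality is obtained by refuting both strict inequalities.
  ≮∧≯⇒≈ : ¬ x < y → ¬ y < x → x ≈ y
  ≮∧≯⇒≈ {x} {y} x≮y y≮x = proj₁ (tight x y) ([ x≮y , y≮x ] ∘ #⇒<⊎>)

  +-monoˡ-< : ∀ z → x < y → x + z < y + z
  +-monoˡ-< {x} {y} z x<y =
    <.<-respʳ-≈ (+-comm z y) (<.<-respˡ-≈ (+-comm z x) (+-monoʳ-< z x<y))

  x+y-y≈x : ∀ x y → x + y - y ≈ x
  x+y-y≈x x y = trans (+-assoc x y (- y)) (trans (+-congˡ (-‿inverseʳ y)) (+-identityʳ x))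

  x-y+y≈x : ∀ x y → x - y + y ≈ x
  x-y+y≈x x y = trans (+-assoc x (- y) y) (trans (+-congˡ (-‿inverseˡ y)) (+-identityʳ x))

  -z+[z+x]≈x : ∀ z x → - z + (z + x) ≈ x
  -z+[z+x]≈x z x =
    trans (sym (+-assoc (- z) z x)) (trans (+-congʳ (-‿inverseˡ z)) (+-identityˡ x))

  +-cancelˡ-< : ∀ z → z + x < z + y → x < y
  +-cancelˡ-< {x} {y} z z+x<z+y =
    <.<-respʳ-≈ (-z+[z+x]≈x z y) (<.<-respˡ-≈ (-z+[z+x]≈x z x) (+-monoʳ-< (- z) z+x<z+y))

  x<y⇒0<y-x : x < y → 0# < y - x
  x<y⇒0<y-x {x} x<y = <.<-respˡ-≈ (-‿inverseʳ x) (+-monoˡ-< (- x) x<y)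

  0<y-x⇒x<y : 0# < y - x → x < y
  0<y-x⇒x<y {y} {x} 0<y-x =
    <.<-respʳ-≈ (x-y+y≈x y x) (<.<-respˡ-≈ (+-identityˡ x) (+-monoˡ-< x 0<y-x))

  0<x⇒-x<0 : 0# < x → - x < 0#
  0<x⇒-x<0 {x} 0<x =
    <.<-respʳ-≈ (-‿inverseʳ x) (<.<-respˡ-≈ (+-identityˡ (- x)) (+-monoˡ-< (- x) 0<x))

  *-monoˡ-< : 0# < z → x < y → x * z < y * z
  *-monoˡ-< {z} {x} {y} 0<z x<y =
    0<y-x⇒x<y (<.<-respʳ-≈ ([y-z]x≈yx-zx z y x) (*-pos (x<y⇒0<y-x x<y) 0<z))

  *-monoʳ-< : 0# < z → x < y → z * x < z * y
  *-monoʳ-< {z} {x} {y} 0<z x<y =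
    <.<-respʳ-≈ (*-comm y z) (<.<-respˡ-≈ (*-comm x z) (*-monoˡ-< 0<z x<y))

  -- Invertibility makes `x` apart from 0, which leaves only the two signs to decide between.
  inverse-pos : 0# < y → x * y ≈ 1# → 0# < x
  inverse-pos {y} {x} 0<y xy≈1 with #⇒<⊎> x#0
    where
    x#0 : x # 0#
    x#0 = invertibleʳ⇒# (y , trans (*-congʳ (x-0≈x x)) xy≈1)
  ... | inj₂ 0<x = 0<x
  -- A negative `x` would give 1 = xy < 0y = 0.
  ... | inj₁ x<0 = contradiction (<.<-respˡ-≈ xy≈1 (<.<-respʳ-≈ (zeroˡ y) (*-monoˡ-< 0<y x<0)))
                     (<.asym 0<1)

  -- Division

  private
    inverseˡ : (y#0 : y # 0#) → proj₁ (#⇒invertible y#0) * y ≈ 1#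
    -- `#⇒invertible` inverts `y - 0#`, so `y` is first rewritten into that shape.
    inverseˡ {y} y#0 =
      trans (*-congˡ (sym (x-0≈x y))) (proj₁ (proj₂ (#⇒invertible y#0)))

  [x÷y]*y≈x : ∀ x (y#0 : y # 0#) → (x ÷ y ⟨ y#0 ⟩) * y ≈ x
  [x÷y]*y≈x {y} x y#0 =
    trans (*-assoc x _ y) (trans (*-congˡ (inverseˡ y#0)) (*-identityʳ x))

  [x*y]÷y≈x : ∀ x (y#0 : y # 0#) → (x * y) ÷ y ⟨ y#0 ⟩ ≈ x
  [x*y]÷y≈x {y} x y#0 =
    trans (*-assoc x y _)
      (trans (*-congˡ (trans (*-comm y _) (inverseˡ y#0))) (*-identityʳ x))

  x*[y÷z]≈[x*y]÷z : ∀ x y (z#0 : z # 0#) → x * (y ÷ z ⟨ z#0 ⟩) ≈ (x * y) ÷ z ⟨ z#0 ⟩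
  x*[y÷z]≈[x*y]÷z x y z#0 = sym (*-assoc x y _)

  [x÷z]*y≈[x*y]÷z : ∀ x y (z#0 : z # 0#) → (x ÷ z ⟨ z#0 ⟩) * y ≈ (x * y) ÷ z ⟨ z#0 ⟩
  [x÷z]*y≈[x*y]÷z x y z#0 =
    trans (*-assoc x _ y) (trans (*-congˡ (*-comm _ y)) (sym (*-assoc x y _)))

  ÷-monoˡ-< : 0# < z → (z#0 : z # 0#) → x < y → x ÷ z ⟨ z#0 ⟩ < y ÷ z ⟨ z#0 ⟩
  ÷-monoˡ-< 0<z z#0 = *-monoˡ-< (inverse-pos 0<z (inverseˡ z#0))

  ÷-pos : 0# < x → 0# < y → (y#0 : y # 0#) → 0# < x ÷ y ⟨ y#0 ⟩
  ÷-pos 0<x 0<y y#0 = *-pos 0<x (inverse-pos 0<y (inverseˡ y#0))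

  ≈-cong-⇔ : ∀ {x x′ y y′} → x ≈ x′ → y ≈ y′ → x ≈ y ⇔ x′ ≈ y′
  ≈-cong-⇔ x≈x′ y≈y′ = mk⇔ (λ x≈y → trans (sym x≈x′) (trans x≈y y≈y′))
                           (λ x′≈y′ → trans x≈x′ (trans x′≈y′ (sym y≈y′)))

  ≈-sym-⇔ : x ≈ y ⇔ y ≈ x
  ≈-sym-⇔ = mk⇔ sym sym

  x*z≈y⇔x≈y÷z : (z#0 : z # 0#) → x * z ≈ y ⇔ x ≈ y ÷ z ⟨ z#0 ⟩
  x*z≈y⇔x≈y÷z {x = x} {y} z#0 = mk⇔
    (λ xz≈y → trans (sym ([x*y]÷y≈x x z#0)) (*-congʳ xz≈y))
    (λ x≈y÷z → trans (*-congʳ x≈y÷z) ([x÷y]*y≈x y z#0))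

  x≈y-z⇔z+x≈y : x ≈ y - z ⇔ z + x ≈ y
  x≈y-z⇔z+x≈y {x} {y} {z} = mk⇔
    (λ x≈y-z → trans (+-comm z x) (trans (+-congʳ x≈y-z) (x-y+y≈x y z)))
    (λ z+x≈y → trans (sym (x+y-y≈x x z)) (+-congʳ (trans (+-comm x z) z+x≈y)))

  -- Natural numbers

  fromℕ-mono-< : ∀ {m n} → m ℕ.< n → fromℕ m < fromℕ n
  fromℕ-mono-< {zero}  {suc n} _           = fromℕ-positive (suc n)
  fromℕ-mono-< {suc m} {suc n} (ℕ.s≤s m<n) = +-monoʳ-< 1# (fromℕ-mono-< m<n)

  -- Exponential and logarithm

  0<1+x⇒0<exp : 0# < 1# + x → 0# < exp x
  0<1+x⇒0<exp {x} 0<1+x = <-≤-trans 0<1+x (1+x≤exp x)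

  exp*exp[-x]≈1 : ∀ x → exp x * exp (- x) ≈ 1#
  exp*exp[-x]≈1 x =
    trans (sym (exp.homo x (- x))) (trans (exp.⟦⟧-cong (-‿inverseʳ x)) exp.ε-homo)

  -- The bound 1 + x ≤ exp x settles the case 0 < 1 + x. Otherwise x < 0, the same bound makes exp
  -- (-x) positive, and exp x is its inverse. Comparing 1 + x with 0 < 1 yields overlapping cases,
  -- so no sign of x has to be decided.
  exp-pos : ∀ x → 0# < exp x
  exp-pos x with <-cotrans 0<1 (1# + x)
  ... | inj₁ 0<1+x = 0<1+x⇒0<exp 0<1+x
  ... | inj₂ 1+x<1 = inverse-pos (0<1+x⇒0<exp 0<1-x) (exp*exp[-x]≈1 x)
    where
    0<1-x : 0# < 1# - x
    0<1-x = <.trans 0<1 (<.<-respˡ-≈ (x+y-y≈x 1# x) (+-monoˡ-< (- x) 1+x<1))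

  -- The quotient of exp y by exp x is exp (y - x), which is at least 1 + (y - x) and so exceeds 1.
  exp-mono-< : x < y → exp x < exp y
  exp-mono-< {x} {y} x<y = begin-strict
    exp x               ≈⟨ *-identityˡ (exp x) ⟨
    1# * exp x          <⟨ *-monoˡ-< (exp-pos x) 1<exp[y-x] ⟩
    exp (y - x) * exp x ≈⟨ exp.homo (y - x) x ⟨
    exp (y - x + x)     ≈⟨ exp.⟦⟧-cong (x-y+y≈x y x) ⟩
    exp y               ∎
    where
    open <-Reasoning
    1<exp[y-x] : 1# < exp (y - x)
    1<exp[y-x] = <-≤-trans
      (<.<-respˡ-≈ (+-identityʳ 1#) (+-monoʳ-< 1# (x<y⇒0<y-x x<y))) (1+x≤exp (y - x))

  exp-injective : exp x ≈ exp y → x ≈ y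
  exp-injective ex≈ey = ≮∧≯⇒≈ (<.irrefl ex≈ey ∘ exp-mono-<) (<.irrefl (sym ex≈ey) ∘ exp-mono-<)

  -- Contraposing monotonicity would yield only `x ≤ y`. The strict inequality comes directly from 1
  -- + (x - y) ≤ exp (x - y) < 1.
  exp-cancel-< : exp x < exp y → x < y
  exp-cancel-< {x} {y} ex<ey =
    <.<-respˡ-≈ (x-y+y≈x x y) (<.<-respʳ-≈ (+-identityˡ y) (+-monoˡ-< y x-y<0))
    where
    exp[x-y]<1 : exp (x - y) < 1#
    exp[x-y]<1 = <.<-respˡ-≈ (sym (exp.homo x (- y)))
      (<.<-respʳ-≈ (exp*exp[-x]≈1 y) (*-monoˡ-< (exp-pos (- y)) ex<ey))
    x-y<0 : x - y < 0#
    x-y<0 = +-cancelˡ-< 1#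
      (<.<-respʳ-≈ (sym (+-identityʳ 1#)) (≤-<-trans (1+x≤exp (x - y)) exp[x-y]<1))

  exp-≈-⇔ : exp x ≈ exp y ⇔ x ≈ y
  exp-≈-⇔ = mk⇔ exp-injective exp.⟦⟧-cong

  log-mono-< : ∀ {x>0 y>0} → x < y → log x x>0 < log y y>0
  log-mono-< {x} {y} {x>0} {y>0} x<y = exp-cancel-<
    (<.<-respˡ-≈ (sym (exp-log x x>0)) (<.<-respʳ-≈ (sym (exp-log y y>0)) x<y))

  -- `log` takes a positivity proof and is not assumed to respect `≈` or to ignore that proof; both
  -- facts follow from injectivity of `exp`.
  log-cong : ∀ {x>0 y>0} → x ≈ y → log x x>0 ≈ log y y>0
  log-cong {x} {y} {x>0} {y>0} x≈y =
    exp-injective (trans (exp-log x x>0) (trans x≈y (sym (exp-log y y>0))))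

  log-pos : ∀ {x>0} → 1# < x → 0# < log x x>0
  log-pos {x} {x>0} 1<x = exp-cancel-<
    (<.<-respˡ-≈ (sym exp.ε-homo) (<.<-respʳ-≈ (sym (exp-log x x>0)) 1<x))

  logℕ-pos : ∀ {m} {{_ : ℕ.NonZero m}} → 1 ℕ.< m → 0# < logℕ m
  logℕ-pos 1<m = log-pos (<.<-respˡ-≈ (+-identityʳ 1#) (fromℕ-mono-< 1<m))

  -- Bridge from integer powers to `exp`, through which bounds on naturals become bounds on
  -- logarithms.
  fromℕ-^ : ∀ m {{_ : ℕ.NonZero m}} n → fromℕ (m ℕ.^ n) ≈ exp (fromℕ n * logℕ m)
  fromℕ-^ m zero    = trans (+-identityʳ 1#)
    (trans (sym exp.ε-homo) (exp.⟦⟧-cong (sym (zeroˡ (logℕ m)))))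
  fromℕ-^ m (suc n) = begin
    fromℕ (m ℕ.* m ℕ.^ n)                  ≈⟨ ×1-homo-* m (m ℕ.^ n) ⟩
    fromℕ m * fromℕ (m ℕ.^ n)              ≈⟨ *-cong (sym (exp-log _ _)) (fromℕ-^ m n) ⟩
    exp (logℕ m) * exp (fromℕ n * logℕ m)   ≈⟨ exp.homo _ _ ⟨
    exp (logℕ m + fromℕ n * logℕ m)         ≈⟨ exp.⟦⟧-cong (+-congʳ (*-identityˡ (logℕ m))) ⟨
    exp (1# * logℕ m + fromℕ n * logℕ m)    ≈⟨ exp.⟦⟧-cong (distribʳ (logℕ m) 1# (fromℕ n)) ⟨
    exp ((1# + fromℕ n) * logℕ m)           ∎
    where open ≈-Reasoning

  -- The shape of a big-O bound with constant 1; positivity of `x` serves the bound on `- x`, since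
  -- -x < 0 < x < y.
  0<x<y⇒∣x∣≤1*y : 0# < x → x < y → x ≤ 1# * y × - x ≤ 1# * y
  0<x<y⇒∣x∣≤1*y {x} {y} 0<x x<y =
    <⇒≤ x<1*y , <⇒≤ (<.trans (<.trans (0<x⇒-x<0 0<x) 0<x) x<1*y)
    where
    x<1*y : x < 1# * y
    x<1*y = <.<-respʳ-≈ (sym (*-identityˡ y)) x<y

  -- Estimates for fixed parameters

  module _ (p : Parameters) where

    open Parameters p
    open Conditions p

    private
      log-k log-r n+1 : ℝ
      log-k = logℕ k
      log-r = logℕ r
      n+1   = fromℕ (suc n)

      a : ℝ
      a = n+1 * log-r/log-k

      log-k>0 : 0# < log-k
      log-k>0 = logℕ-pos k>1

      log-r>0 : 0# < log-r
      log-r>0 = logℕ-pos r>1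

      n+1>0 : 0# < n+1
      n+1>0 = fromℕ-positive (suc n)

    k<rⁿ⁺¹ : k ℕ.< r ℕ.^ suc n
    k<rⁿ⁺¹ = ℕ.≤-<-trans (ℕ.m≤n⊔m r k) (ℕ.<-trans W>max W<rⁿ⁺¹)

    log-k<[n+1]*log-r : log-k < n+1 * log-r
    log-k<[n+1]*log-r = exp-cancel-< (<.<-respˡ-≈ (sym (exp-log _ _))
      (<.<-respʳ-≈ (fromℕ-^ r (suc n)) (fromℕ-mono-< k<rⁿ⁺¹)))

    exponentLowerBound : ExponentLowerBound
    exponentLowerBound = begin-strict
      log-k/log-r - 1#                          <⟨ +-monoˡ-< (- 1#)
                                                     (÷-monoˡ-< log-r>0 _ log-k<[n+1]*log-r) ⟩
      (n+1 * log-r) ÷ log-r ⟨ logℕ#0 r ⟩ - 1#   ≈⟨ +-congʳ ([x*y]÷y≈x n+1 (logℕ#0 r)) ⟩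
      1# + fromℕ n - 1#                         ≈⟨ +-congʳ (+-comm 1# (fromℕ n)) ⟩
      fromℕ n + 1# - 1#                         ≈⟨ x+y-y≈x (fromℕ n) 1# ⟩
      fromℕ n                                   ∎
      where open <-Reasoning

    [n+1]th-root-of-k<r : [n+1]th-root-of-k < r-as-real
    -- With r written as exp (log r), it suffices to compare exponents: (log k) / (n + 1) < log r.
    [n+1]th-root-of-k<r = <.<-respʳ-≈ (exp-log _ _) (exp-mono-< (begin-strict
      (1# ÷ n+1 ⟨ n+1#0 ⟩) * log-k    ≈⟨ [x÷z]*y≈[x*y]÷z 1# log-k n+1#0 ⟩
      (1# * log-k) ÷ n+1 ⟨ n+1#0 ⟩    ≈⟨ *-congʳ (*-identityˡ log-k) ⟩
      log-k ÷ n+1 ⟨ n+1#0 ⟩           <⟨ ÷-monoˡ-< n+1>0 n+1#0 log-k<[n+1]*log-r ⟩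
      (n+1 * log-r) ÷ n+1 ⟨ n+1#0 ⟩   ≈⟨ *-congʳ (*-comm n+1 log-r) ⟩
      (log-r * n+1) ÷ n+1 ⟨ n+1#0 ⟩   ≈⟨ [x*y]÷y≈x log-r n+1#0 ⟩
      log-r                           ∎))
      where
      open <-Reasoning
      n+1#0 : n+1 # 0#
      n+1#0 = fromℕ#0 (suc n)

    W/rⁿ<r : W/rⁿ < r-as-real
    W/rⁿ<r = begin-strict
      W/rⁿ                                             <⟨ ÷-monoˡ-< rⁿ>0 rⁿ#0 (fromℕ-mono-< W<rⁿ⁺¹) ⟩
      fromℕ (r ℕ.^ suc n) ÷ rⁿ ⟨ rⁿ#0 ⟩                ≈⟨ *-congʳ (×1-homo-* r (r ℕ.^ n)) ⟩
      (fromℕ r * rⁿ) ÷ rⁿ ⟨ rⁿ#0 ⟩                     ≈⟨ [x*y]÷y≈x (fromℕ r) rⁿ#0 ⟩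
      fromℕ r                                          ∎
      where
      open <-Reasoning
      rⁿ : ℝ
      rⁿ = fromℕ (r ℕ.^ n)
      rⁿ>0 : 0# < rⁿ
      rⁿ>0 = fromℕ-positive (r ℕ.^ n)
      rⁿ#0 : rⁿ # 0#
      rⁿ#0 = fromℕ#0 (r ℕ.^ n)

    W/rⁿ>0 : 0# < W/rⁿ
    W/rⁿ>0 = ÷-pos (fromℕ-mono-< (IsVanDerWaerden.positive isVanDerWaerden))
               (fromℕ-positive (r ℕ.^ n)) (fromℕ#0 (r ℕ.^ n))

    -- The two equations characterising `a`

    b*log-k≈[n+1]*log-r⇔b≈a : ∀ b → b * log-k ≈ n+1 * log-r ⇔ b ≈ a
    b*log-k≈[n+1]*log-r⇔b≈a b = begin
      b * log-k ≈ n+1 * log-r                     ≈⟨ x*z≈y⇔x≈y÷z (logℕ#0 k) ⟩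
      b ≈ (n+1 * log-r) ÷ log-k ⟨ logℕ#0 k ⟩      ≈⟨ ≈-cong-⇔ refl (sym (x*[y÷z]≈[x*y]÷z n+1 log-r (logℕ#0 k))) ⟩
      b ≈ a                                       ∎
      where open ⇔-Reasoning

    exponentEquation⇔b≈a : ∀ b → SatisfiesExponentEquation b ⇔ b ≈ a
    exponentEquation⇔b≈a b = begin
      fromℕ n ≈ b * log-k/log-r - 1#              ≈⟨ x≈y-z⇔z+x≈y ⟩
      -- Moving the 1 across gives `1# + fromℕ n`, to which `n+1` unfolds definitionally.
      n+1 ≈ b * log-k/log-r                       ≈⟨ ≈-cong-⇔ refl (x*[y÷z]≈[x*y]÷z b log-k (logℕ#0 r)) ⟩
      n+1 ≈ (b * log-k) ÷ log-r ⟨ logℕ#0 r ⟩      ≈⟨ x*z≈y⇔x≈y÷z (logℕ#0 r) ⟨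
      n+1 * log-r ≈ b * log-k                     ≈⟨ ≈-sym-⇔ ⟩
      b * log-k ≈ n+1 * log-r                     ≈⟨ b*log-k≈[n+1]*log-r⇔b≈a b ⟩
      b ≈ a                                       ∎
      where open ⇔-Reasoning

    -- Injectivity of `exp` reduces the equation to its exponents, and apartness of `b` from 0
    -- allows the denominator to be cleared reversibly.
    powerEquation⇔b≈a : ∀ b b#0 → SatisfiesPowerEquation b b#0 ⇔ b ≈ a
    powerEquation⇔b≈a b b#0 = begin
      fromℕ k ≈ exp ((n+1 ÷ b ⟨ b#0 ⟩) * log-r)    ≈⟨ ≈-cong-⇔ (sym (exp-log _ _)) refl ⟩
      exp log-k ≈ exp ((n+1 ÷ b ⟨ b#0 ⟩) * log-r)  ≈⟨ exp-≈-⇔ ⟩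
      log-k ≈ (n+1 ÷ b ⟨ b#0 ⟩) * log-r            ≈⟨ ≈-cong-⇔ refl ([x÷z]*y≈[x*y]÷z n+1 log-r b#0) ⟩
      log-k ≈ (n+1 * log-r) ÷ b ⟨ b#0 ⟩            ≈⟨ x*z≈y⇔x≈y÷z b#0 ⟨
      log-k * b ≈ n+1 * log-r                      ≈⟨ ≈-cong-⇔ (*-comm log-k b) refl ⟩
      b * log-k ≈ n+1 * log-r                      ≈⟨ b*log-k≈[n+1]*log-r⇔b≈a b ⟩
      b ≈ a                                        ∎
      where open ⇔-Reasoning

    a>0 : 0# < a
    a>0 = *-pos n+1>0 (÷-pos log-r>0 log-k>0 (logℕ#0 k))

    -- Writing n + 1 as (n + 1) (log k / log k) puts it in the same form as `a`, so only log r and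
    -- log k remain to be compared.
    a-comparison : Comparison a
    a-comparison = less , equal , greater
      where
      log-k/log-k≈1 : log-k ÷ log-k ⟨ logℕ#0 k ⟩ ≈ 1#
      log-k/log-k≈1 = trans (*-congʳ (sym (*-identityˡ log-k))) ([x*y]÷y≈x 1# (logℕ#0 k))
      n+1*[log-k/log-k]≈n+1 : n+1 * (log-k ÷ log-k ⟨ logℕ#0 k ⟩) ≈ n+1
      n+1*[log-k/log-k]≈n+1 = trans (*-congˡ log-k/log-k≈1) (*-identityʳ n+1)
      less : r ℕ.< k → a < n+1
      less r<k = <.<-respʳ-≈ n+1*[log-k/log-k]≈n+1
        (*-monoʳ-< n+1>0 (÷-monoˡ-< log-k>0 (logℕ#0 k) (log-mono-< (fromℕ-mono-< r<k))))
      equal : r ≡.≡ k → a ≈ n+1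
      equal r≡k = trans (*-congˡ (*-congʳ (log-cong (reflexive (≡.cong fromℕ r≡k)))))
        n+1*[log-k/log-k]≈n+1
      greater : r ℕ.> k → a > n+1
      greater r>k = <.<-respˡ-≈ n+1*[log-k/log-k]≈n+1
        (*-monoʳ-< n+1>0 (÷-monoˡ-< log-k>0 (logℕ#0 k) (log-mono-< (fromℕ-mono-< r>k))))

    exponentFormula : ExponentFormula
    exponentFormula =
      -- The equivalence read backwards at `a` itself shows that `a` is a solution.
      a , Equivalence.from (exponentEquation⇔b≈a a) refl , exponentEquation⇔b≈a , a-comparison

    powerFormula : PowerFormula
    powerFormula =
      a , a#0 , Equivalence.from (powerEquation⇔b≈a a a#0) refl , powerEquation⇔b≈a , a-comparison
      where
      a#0 : a # 0#
      a#0 = #-sym (<⇒# a>0)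

theorem2p3 : ∀ {c ℓ₁ ℓ₂} (R : RealNumbers c ℓ₁ ℓ₂) (E : ExpLog R) →
    (∀ p → Analysis.Conditions.ExponentLowerBound R E p) ×
    Analysis._=O_ R E (Analysis.Conditions.[n+1]th-root-of-k R E) (Analysis.Conditions.r-as-real R E) ×
    (∀ p → Analysis.Conditions.ExponentFormula R E p) ×
    (∀ p → Analysis.Conditions.PowerFormula R E p) ×
    Analysis._=O_forLarge_ R E (Analysis.Conditions.W/rⁿ R E) (Analysis.Conditions.r-as-real R E) Parameters.n
theorem2p3 R E =
    exponentLowerBound R E
  -- The root is by definition a value of `exp`, hence positive.
  , (1# , λ p → 0<x<y⇒∣x∣≤1*y R E (exp-pos R E _) ([n+1]th-root-of-k<r R E p))
  , exponentFormula R E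
  , powerFormula R E
  -- The threshold is 0 because the bound holds for every admissible n.
  , (0 , 1# , λ p _ → 0<x<y⇒∣x∣≤1*y R E (W/rⁿ>0 R E p) (W/rⁿ<r R E p))
  where open RealNumbers R using (1#)
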